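{- For all $x,j,s\in\mathbb{N}$ with $j+2\le s$, $$E_{s-j}(J_j(x))=E_s(x),$$ where $J_j$ is shift right by $j$ with jamming and $E_s$ is nearest-even rounding of a natural number divided by $2^s$.
   Context: For natural numbers $x,j$, shift right with jamming is $$J_j(x)=\begin{cases}\lfloor x/2^j\rfloor,& x\bmod 2^j=0,\\ \lfloor x/2^j\rfloor\ \mathrm{OR}\ 1,& x\bmod 2^j\ne0,\end{cases}$$ where $\mathrm{OR}$ is bitwise or on natural numbers (so the low bit is set when the discarded suffix is nonzero). For $s>0$ write uniquely $x=q2^s+g2^{s-1}+r$ with $q\in\mathbb{N}$, $g\in\{0,1\}$, $0\le r<2^{s-1}$. Then $$E_s(x)=q+\mathbf{1}\bigl[g=1\ \wedge\ (r\ne0\ \vee\ q\text{ is odd})\bigr],$$ i.e. $x/2^s$ rounded to the nearest integer with ties to even. -}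

module Defs where

open import Data.Bool.Base using (if_then_else_)
open import Data.Nat.Base
  using (ℕ; zero; suc; pred; _+_; _*_; _∸_; _^_; _⊔_; _≤_; _<_; NonZero; >-nonZero; z<s)
open import Data.Nat.DivMod using (_/_; _%_; m≡m%n+[m/n]*n; m%n<n)
open import Data.Nat.Properties
  using (_≟_; m^n≢0; m<n⇒0<n∸m; m<m+n; <-≤-trans)
open import Data.Nat.Solver using (module +-*-Solver)
open import Data.Product.Base using (_×_)
open import Data.Sum.Base using (_⊎_)
open import Relation.Binary.PropositionalEquality
  using (_≡_; _≢_; refl; cong; module ≡-Reasoning)
open import Relation.Nullary using (Dec; does; ¬?; _×-dec_; _⊎-dec_)

-- Bitwise or of the k least significant bits; on the bits 0 and 1, or is ⊔.
orBits : ℕ → ℕ → ℕ → ℕ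
orBits zero    m n = 0
orBits (suc k) m n = (m % 2 ⊔ n % 2) + 2 * orBits k (m / 2) (n / 2)

-- Since a < 2 ^ a, both m and n have at most m ⊔ n bits, so none is dropped.
infixl 6 _OR_
_OR_ : ℕ → ℕ → ℕ
m OR n = orBits (m ⊔ n) m n

J : ℕ → ℕ → ℕ
J j x = if does (x % 2 ^ j ≟ 0) then x / 2 ^ j else (x / 2 ^ j) OR 1
  where instance _ = m^n≢0 2 j

record Split (s x : ℕ) : Set where
  field
    q g r   : ℕ
    g<2     : g < 2
    r<2^s-1 : r < 2 ^ pred s
    x≡      : x ≡ q * 2 ^ s + g * 2 ^ pred s + r

split : ∀ s .{{_ : NonZero s}} x → Split s x
split (suc s) x = record
  { q       = h / 2
  ; g       = h % 2
  ; r       = x % 2 ^ s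
  ; g<2     = m%n<n h 2
  ; r<2^s-1 = m%n<n x (2 ^ s)
  ; x≡      = begin
      x                                                     ≡⟨ m≡m%n+[m/n]*n x (2 ^ s) ⟩
      x % 2 ^ s + h * 2 ^ s                                 ≡⟨ cong (λ y → x % 2 ^ s + y * 2 ^ s) (m≡m%n+[m/n]*n h 2) ⟩
      x % 2 ^ s + (h % 2 + h / 2 * 2) * 2 ^ s               ≡⟨ regroup (x % 2 ^ s) (h % 2) (h / 2) (2 ^ s) ⟩
      h / 2 * 2 ^ suc s + h % 2 * 2 ^ s + x % 2 ^ s         ∎
  }
  where
  open ≡-Reasoning
  open +-*-Solver
  instance _ = m^n≢0 2 s
  h = x / 2 ^ s
  regroup : ∀ r g q p → r + (g + q * 2) * p ≡ q * (2 * p) + g * p + r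
  regroup = solve 4 (λ r g q p →
    r :+ (g :+ q :* con 2) :* p := q :* (con 2 :* p) :+ g :* p :+ r) refl

𝟏 : ∀ {P : Set} → Dec P → ℕ
𝟏 P? = if does P? then 1 else 0

Odd : ℕ → Set
Odd n = n % 2 ≡ 1

RoundsUp : (q g r : ℕ) → Set
RoundsUp q g r = g ≡ 1 × (r ≢ 0 ⊎ Odd q)

roundsUp? : ∀ q g r → Dec (RoundsUp q g r)
roundsUp? q g r = (g ≟ 1) ×-dec (¬? (r ≟ 0) ⊎-dec (q % 2 ≟ 1))

E : ∀ s .{{_ : NonZero s}} → ℕ → ℕ
E s x = q + 𝟏 (roundsUp? q g r)
  where open Split (split s x)

j+2≤s⇒s≢0 : ∀ {j s} → j + 2 ≤ s → NonZero s
j+2≤s⇒s≢0 {zero}  {suc s} _ = _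
j+2≤s⇒s≢0 {suc j} {suc s} _ = _

j+2≤s⇒s∸j≢0 : ∀ {j s} → j + 2 ≤ s → NonZero (s ∸ j)
j+2≤s⇒s∸j≢0 {j} j+2≤s = >-nonZero (m<n⇒0<n∸m (<-≤-trans (m<m+n j z<s) j+2≤s))

{-# OPTIONS --safe #-}

-- E s x depends only on ⌊x / 2^(s-1)⌋ and on whether 2^(s-1) divides x.  Jamming
-- preserves both: it changes at most the lowest bit of ⌊x / 2^j⌋, which lies below
-- the guard bit since s - j ≥ 2, and that bit is set exactly when the discarded
-- suffix is nonzero, in which case neither x nor J j x is divisible by the
-- respective power of two.

module Submission where

open import Defs
open import Data.Bool.Base using (if_then_else_)
open import Data.Nat
  using (ℕ; zero; suc; _+_; _*_; _∸_; _^_; _/_; _%_; _⊔_; _≤_; NonZero; z≤n; s≤s; s≤s⁻¹; z<s; s<s)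
open import Data.Nat.Divisibility
open import Data.Nat.DivMod
open import Data.Nat.Properties
open import Data.Product.Function.NonDependent.Propositional using (_×-⇔_)
open import Data.Sum.Function.Propositional using (_⊎-⇔_)
open import Function.Base using (_∘_; case_of_)
open import Function.Bundles using (_⇔_; mk⇔; Equivalence)
open import Function.Construct.Composition using (_⇔-∘_)
open import Function.Construct.Identity using (⇔-id)
open import Function.Construct.Symmetry using (⇔-sym)
open import Relation.Binary.PropositionalEquality
  using (_≡_; refl; sym; trans; cong; cong₂; subst; module ≡-Reasoning)
open import Relation.Nullary using (Dec; yes; no; contradiction)
open import Relation.Nullary.Decidable using (does-⇔; dec-true; dec-false)

-- Induction on the fuel `k`: halving a positive number makes it strictly smaller, so `n ≤ suc k`
-- leaves `n / 2 ≤ k` for the recursive call.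
orBits-identityʳ : ∀ {k n} → n ≤ k → orBits k n 0 ≡ n
orBits-identityʳ {zero}          z≤n = refl
orBits-identityʳ {suc k} {zero}  _   = cong (2 *_) (orBits-identityʳ {k} z≤n)
orBits-identityʳ {suc k} {n@(suc _)} n≤1+k = begin
  (n % 2 ⊔ 0) + 2 * orBits k (n / 2) 0 ≡⟨ cong₂ (λ a b → a + 2 * b) (⊔-identityʳ (n % 2)) (orBits-identityʳ n/2≤k) ⟩
  n % 2 + 2 * (n / 2)                  ≡⟨ cong (n % 2 +_) (*-comm 2 (n / 2)) ⟩
  n % 2 + n / 2 * 2                    ≡⟨ m≡m%n+[m/n]*n n 2 ⟨
  n                                    ∎
  where
  open ≡-Reasoning
  n/2≤k : n / 2 ≤ k
  n/2≤k = s≤s⁻¹ (≤-trans (m/n<m n 2 (s<s z<s)) n≤1+k)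

-- Only the lowest bit meets the 1; above it the second operand is 0. In this form the quotient and
-- the remainder by 2 can be read off.
n-OR-1 : ∀ n → n OR 1 ≡ 1 + n / 2 * 2
n-OR-1 zero      = refl
n-OR-1 n@(suc m) = begin
  (n % 2 ⊔ 1) + 2 * orBits (m ⊔ 0) (n / 2) 0 ≡⟨ cong₂ (λ a b → a + 2 * b) (m≤n⇒m⊔n≡n (s≤s⁻¹ (m%n<n n 2))) (orBits-identityʳ n/2≤m⊔0) ⟩
  1 + 2 * (n / 2)                            ≡⟨ cong suc (*-comm 2 (n / 2)) ⟩
  1 + n / 2 * 2                              ∎
  where
  open ≡-Reasoning
  n/2≤m⊔0 : n / 2 ≤ m ⊔ 0
  n/2≤m⊔0 = ≤-trans (s≤s⁻¹ (m/n<m n 2 (s<s z<s))) (m≤m⊔n m 0)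

[n-OR-1]/2 : ∀ n → (n OR 1) / 2 ≡ n / 2
[n-OR-1]/2 n = begin
  (n OR 1) / 2        ≡⟨ cong (_/ 2) (n-OR-1 n) ⟩
  (1 + n / 2 * 2) / 2 ≡⟨ +-distrib-/-∣ʳ 1 (n∣m*n (n / 2) {2}) ⟩
  n / 2 * 2 / 2       ≡⟨ m*n/n≡m (n / 2) 2 ⟩
  n / 2               ∎
  where open ≡-Reasoning

2∤n-OR-1 : ∀ n → 2 ∤ (n OR 1)
2∤n-OR-1 n 2∣ = contradiction 1≡0 λ ()
  where
  open ≡-Reasoning
  1≡0 : 1 ≡ 0
  1≡0 = begin
    1                   ≡⟨ [m+kn]%n≡m%n 1 (n / 2) 2 ⟨
    (1 + n / 2 * 2) % 2 ≡⟨ cong (_% 2) (n-OR-1 n) ⟨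
    (n OR 1) % 2        ≡⟨ n∣m⇒m%n≡0 (n OR 1) 2 2∣ ⟩
    0                   ∎

module _ (j : ℕ) where

  private instance _ = m^n≢0 2 j

  J-exact : ∀ {x} → 2 ^ j ∣ x → J j x ≡ x / 2 ^ j
  J-exact {x} 2^j∣x =
    cong (if_then x / 2 ^ j else (x / 2 ^ j) OR 1)
         (dec-true (x % 2 ^ j ≟ 0) (n∣m⇒m%n≡0 x (2 ^ j) 2^j∣x))

  J-inexact : ∀ {x} → 2 ^ j ∤ x → J j x ≡ (x / 2 ^ j) OR 1
  J-inexact {x} 2^j∤x =
    cong (if_then x / 2 ^ j else (x / 2 ^ j) OR 1)
         (dec-false (x % 2 ^ j ≟ 0) (2^j∤x ∘ m%n≡0⇒n∣m x (2 ^ j)))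

  -- The bit that jamming may set is the one that halving discards.
  J/2 : ∀ x → J j x / 2 ≡ x / 2 ^ j / 2
  J/2 x = case 2 ^ j ∣? x of λ where
    (yes 2^j∣x) → cong (_/ 2) (J-exact 2^j∣x)
    (no  2^j∤x) → trans (cong (_/ 2) (J-inexact 2^j∤x)) ([n-OR-1]/2 (x / 2 ^ j))

  module _ (k : ℕ) where

    private instance
      _ = m^n≢0 2 k
      _ = m^n≢0 2 (suc k)
      _ = m^n≢0 2 (j + suc k)
      _ = m*n≢0 (2 ^ j) (2 ^ suc k)

    -- The exponent `suc k` guarantees one halving, which absorbs the jammed bit; the rest is
    -- regrouping of iterated division.
    J/2^ : ∀ x → J j x / 2 ^ suc k ≡ x / 2 ^ (j + suc k)
    J/2^ x = begin
      J j x / 2 ^ suc k         ≡⟨ m/n/o≡m/[n*o] (J j x) 2 (2 ^ k) ⟨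
      J j x / 2 / 2 ^ k         ≡⟨ cong (_/ 2 ^ k) (J/2 x) ⟩
      x / 2 ^ j / 2 / 2 ^ k     ≡⟨ m/n/o≡m/[n*o] (x / 2 ^ j) 2 (2 ^ k) ⟩
      x / 2 ^ j / 2 ^ suc k     ≡⟨ m/n/o≡m/[n*o] x (2 ^ j) (2 ^ suc k) ⟩
      x / (2 ^ j * 2 ^ suc k)   ≡⟨ /-congʳ (^-distribˡ-+-* 2 j (suc k)) ⟨
      x / 2 ^ (j + suc k)       ∎
      where open ≡-Reasoning

    -- If `2 ^ j` divides `x`, this is divisibility of an exact quotient. Otherwise both sides fail:
    -- `J j x` is odd while `2 ^ suc k` is even, and `2 ^ j` divides `2 ^ (j + suc k)`.
    2^∣J : ∀ x → 2 ^ suc k ∣ J j x ⇔ 2 ^ (j + suc k) ∣ x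
    2^∣J x rewrite ^-distribˡ-+-* 2 j (suc k) = case 2 ^ j ∣? x of λ where
      (yes 2^j∣x) → subst (λ z → 2 ^ suc k ∣ z ⇔ 2 ^ j * 2 ^ suc k ∣ x) (sym (J-exact 2^j∣x))
        (mk⇔ (m∣n/o⇒o*m∣n 2^j∣x) (m*n∣o⇒n∣o/m (2 ^ j) (2 ^ suc k)))
      (no 2^j∤x) → mk⇔
        (λ d → contradiction (m*n∣⇒m∣ 2 (2 ^ k) (subst (2 ^ suc k ∣_) (J-inexact 2^j∤x) d))
                             (2∤n-OR-1 (x / 2 ^ j)))
        (λ d → contradiction (m*n∣⇒m∣ (2 ^ j) (2 ^ suc k) d) 2^j∤x)

𝟏-cong : ∀ {P Q : Set} → P ⇔ Q → (P? : Dec P) (Q? : Dec Q) → 𝟏 P? ≡ 𝟏 Q?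
𝟏-cong P⇔Q P? Q? = cong (if_then 1 else 0) (does-⇔ P⇔Q P? Q?)

-- The remainder enters only through whether it vanishes, so remainders modulo different powers of
-- two can be compared.
RoundsUp-cong : ∀ q g {r r′} → r ≡ 0 ⇔ r′ ≡ 0 → RoundsUp q g r ⇔ RoundsUp q g r′
RoundsUp-cong q g r⇔r′ = ⇔-id _ ×-⇔ (mk⇔ (_∘ from) (_∘ to) ⊎-⇔ ⇔-id _)
  where open Equivalence r⇔r′

module _ (m n : ℕ) where

  private instance
    _ = m^n≢0 2 m
    _ = m^n≢0 2 n

  E-cong : ∀ {x y} → x / 2 ^ m ≡ y / 2 ^ n → 2 ^ m ∣ x ⇔ 2 ^ n ∣ y →
           E (suc m) x ≡ E (suc n) y
  E-cong {x} {y} h≡h′ ∣⇔∣ = begin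
    round (x / 2 ^ m) (x % 2 ^ m) ≡⟨ cong (λ h → round h (x % 2 ^ m)) h≡h′ ⟩
    round (y / 2 ^ n) (x % 2 ^ m) ≡⟨ cong (q +_) (𝟏-cong (RoundsUp-cong q g r⇔r′) (roundsUp? q g _) (roundsUp? q g _)) ⟩
    round (y / 2 ^ n) (y % 2 ^ n) ∎
    where
    open ≡-Reasoning
    -- This is `E` with `split` unfolded; `h` holds the quotient and the guard bit together, so one
    -- equation replaces both.
    round : ℕ → ℕ → ℕ
    round h r = h / 2 + 𝟏 (roundsUp? (h / 2) (h % 2) r)
    q = y / 2 ^ n / 2
    g = y / 2 ^ n % 2
    r⇔r′ : x % 2 ^ m ≡ 0 ⇔ y % 2 ^ n ≡ 0
    r⇔r′ = ⇔-sym (m%n≡0⇔n∣m y (2 ^ n)) ⇔-∘ (∣⇔∣ ⇔-∘ m%n≡0⇔n∣m x (2 ^ m))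

E-J : ∀ {j s d} x .{{_ : NonZero s}} .{{_ : NonZero d}} →
      2 ≤ d → s ≡ j + d → E d (J j x) ≡ E s x
-- Of the two successors in `d`, one is the guard position removed by `E-cong`, the other the bit
-- position where jamming is absorbed. Moving a successor outward with `+-suc` puts `s` in the form
-- `suc (j + suc k)`.
E-J {j} {d = suc (suc k)} x (s≤s (s≤s z≤n)) s≡j+d with refl ← trans s≡j+d (+-suc j (suc k)) =
  E-cong (suc k) (j + suc k) (J/2^ j k x) (2^∣J j k x)

theorem4 : ∀ (x j s : ℕ) (j+2≤s : j + 2 ≤ s) →
    E (s ∸ j) {{j+2≤s⇒s∸j≢0 j+2≤s}} (J j x) ≡ E s {{j+2≤s⇒s≢0 {j} j+2≤s}} x
theorem4 x j s j+2≤s =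
  E-J x {{j+2≤s⇒s≢0 {j} j+2≤s}} {{j+2≤s⇒s∸j≢0 j+2≤s}}
    (m+n≤o⇒m≤o∸n 2 (subst (_≤ s) (+-comm j 2) j+2≤s))
    (sym (m+[n∸m]≡n (m+n≤o⇒m≤o j j+2≤s)))
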